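{- Let $\mathsf{CS}$ be a constant specification for $\mathsf{Base}$. For any formula $A\in\mathcal{L}_{\mathsf J}$: if $\vdash_{\mathsf{JIK}_{\mathsf{CS}}}A$ then $\vDash_{\mathsf m}A$, i.e. $A$ is true at every world of every intuitionistic modular model.
   Context: **Justification language.** Fix countable sets $\mathsf{Prop}$ (propositional variables), $\mathsf{PrfConst}$ (proof constants), $\mathsf{PrfVar}$ (proof variables), $\mathsf{SatVar}$ (satisfier variables). Proof terms $t\in\mathsf{PrfTm}$ and satisfier terms $m\in\mathsf{SatTm}$ are defined by mutual induction: $t ::= c\in\mathsf{PrfConst}\mid x\in\mathsf{PrfVar}\mid t\cdot t\mid t+t\mid {!t}\mid m\triangleright t$ and $m ::= a\in\mathsf{SatVar}\mid m\sqcup m\mid t\star m$. The justification language $\mathcal{L}_{\mathsf J}$ is $A ::= p\in\mathsf{Prop}\mid\bot\mid A\wedge A\mid A\vee A\mid A\to A\mid [t]A\mid\langle m\rangle A$. **The logic $\mathsf{JIK}_{\mathsf{CS}}$.** Let $\mathsf{Int}$ be a finite set of axiom (schemes) for intuitionistic propositional logic (complete with modus ponens). The axiom set $\mathsf{Base}$ is $\mathsf{Int}$ (over $\mathcal{L}_{\mathsf J}$) together with: $[s](A\to B)\to([t]A\to[s\cdot t]B)$; $[s](A\to B)\to(\langle m\rangle A\to\langle s\star m\rangle B)$; $\langle m\rangle(A\vee B)\to(\langle m\rangle A\vee\langle m\rangle B)$; $(\langle m\rangle A\to[t]B)\to[m\triangleright t](A\to B)$; $\langle m\rangle\bot\to\bot$;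 $[s]A\to[s+t]A$; $[t]A\to[s+t]A$; $\langle m\rangle A\to\langle m\sqcup n\rangle A$; $\langle n\rangle A\to\langle m\sqcup n\rangle A$. A constant specification $\mathsf{CS}$ is any set of formulas $[c]A$ with $c\in\mathsf{PrfConst}$ and $A$ an axiom instance of $\mathsf{Base}$. For finite $\Gamma$, $\Gamma\vdash_{\mathsf{JIK}_{\mathsf{CS}}}A$ means $\Gamma\vdash A$ is derivable with: ($\mathsf{ax}$) $\Gamma\vdash A$ for $A$ an axiom instance of $\mathsf{Base}$; ($\mathsf{id}$) $\Gamma\vdash A$ for $A\in\Gamma$; ($\mathsf{mp}$) from $\Gamma\vdash A$ and $\Gamma\vdash A\to B$ infer $\Gamma\vdash B$; ($\mathsf{can}$) $\Gamma\vdash[!^k c]\cdots[!c][c]A$ for any $[c]A\in\mathsf{CS}$ and $k\ge 0$, where $!^k c$ is $k$-fold application of $!$ to $c$. $\vdash_{\mathsf{JIK}_{\mathsf{CS}}}A$ means $\emptyset\vdash_{\mathsf{JIK}_{\mathsf{CS}}}A$. **Basic models.** For sets of formulas $X,Y$ let $X\cdot Y:=\{B\mid A\to B\in X\text{ and }A\in Y\text{ for some }A\}$. A basic (intuitionistic modular) model (for $\mathsf{CS}$) is a tuple $\mathcal B=(W,\le,*)$ with $W$ a non-empty set, $\le$ a preorder on $W$, and $*$ assigning to each $p\in\mathsf{Prop}$ and $w\in W$ a value $p^*_w\in\{0,1\}$ and to each proof or satisfier term $s$ and $w\in W$ a set of formulas $s^*_w\subseteq\mathcal{L}_{\mathsf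 J}$, such that for all $w\in W$, proof terms $s,t$, satisfier terms $m,n$ and formulas $A,B$: (M1) if $w\le v$ and $p^*_w=1$ then $p^*_v=1$; (M2) if $w\le v$ then $t^*_w\subseteq t^*_v$ and $m^*_w\subseteq m^*_v$; (1) $s^*_w\cdot t^*_w\subseteq(s\cdot t)^*_w$; (2) $s^*_w\cdot m^*_w\subseteq(s\star m)^*_w$; (3) $s^*_w\cup t^*_w\subseteq(s+t)^*_w$; (4) $m^*_w\cup n^*_w\subseteq(m\sqcup n)^*_w$; (5) $A\in t^*_w$ for any formula $[t]A$ that is a conclusion of $\mathsf{can}$; (6) if $A\vee B\in m^*_w$ then $A\in m^*_w$ or $B\in m^*_w$; (7) if for all $v\ge w$, $A\notin m^*_v$ or $B\in t^*_v$, then $A\to B\in(m\triangleright t)^*_w$; (8) $\bot\notin m^*_w$. **Truth in basic models.** $\mathcal B,w\Vdash p$ iff $p^*_w=1$; never $\mathcal B,w\Vdash\bot$; $\wedge,\vee$ are evaluated pointwise; $\mathcal B,w\Vdash A\to B$ iff for all $v\ge w$, $\mathcal B,v\Vdash A$ implies $\mathcal B,v\Vdash B$; $\mathcal B,w\Vdash[t]A$ iff $A\in t^*_w$; $\mathcal B,w\Vdash\langle m\rangle A$ iff $A\in m^*_w$. **Modular models.** A quasi-model is a tuple $\mathcal M=(W,\le,R,*)$ where $\mathcal B=(W,\le,*)$ is a basic model and $R$ is a binary relation on $W$; truth is $\mathcal M,w\Vdash A$ iff $\mathcal B,w\Vdash A$. An intuitionistic modular model is a quasi-model $\mathcal M=(W,\le,R,*)$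 such that $(W,\le,R,*|_{\mathsf{Prop}})$ is a birelational model, i.e. $*|_{\mathsf{Prop}}$ is monotone along $\le$ and (BC) if $w\,R\,v\le v'$ then there is $w'$ with $w\le w'\,R\,v'$, (FC) if $w\le w'$ and $w\,R\,v$ then there is $v'$ with $w'\,R\,v'$ and $v\le v'$; and moreover, for all $w\in W$: (JYB) for every proof term $t$ and every $A\in t^*_w$, for all $w',v'$ with $w\le w'\,R\,v'$ we have $\mathcal M,v'\Vdash A$; (SYP) for every satisfier term $m$ and every $A\in m^*_w$, there is $v$ with $w\,R\,v$ and $\mathcal M,v\Vdash A$. $\vDash_{\mathsf m}A$ means $\mathcal M,w\Vdash A$ for every intuitionistic modular model $\mathcal M$ and every $w\in W$. -}

module Defs where

open import Data.Bool using (Bool; true)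
open import Data.Empty.Polymorphic using (⊥)
open import Data.List using (List; []; _∷_)
open import Data.List.Membership.Propositional using () renaming (_∈_ to _∈ˡ_)
open import Data.Nat using (ℕ; zero; suc)
open import Data.Product using (Σ-syntax; ∃; ∃₂; _×_)
open import Data.Sum using (_⊎_)
open import Function.Bundles using (_↣_; _⇔_)
open import Level using (Level; Lift) renaming (zero to 0ℓ; suc to lsuc; _⊔_ to _ℓ⊔_)
open import Relation.Binary using (Rel; IsPreorder)
open import Relation.Binary.PropositionalEquality using (_≡_)
open import Relation.Nullary using (¬_)
open import Relation.Unary using (Pred; _∈_; _∉_; _⊆_; _∪_)

infixr 6 _∧ˢ_
infixr 5 _∨ˢ_
infixr 4 _⇒ˢ_

-- Countable: finite or countably infinite, i.e. injecting into ℕ.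
record Signature : Set₁ where
  field
    PropVar PrfConst PrfVar SatVar : Set
    countable-PropVar  : PropVar  ↣ ℕ
    countable-PrfConst : PrfConst ↣ ℕ
    countable-PrfVar   : PrfVar   ↣ ℕ
    countable-SatVar   : SatVar   ↣ ℕ

module _ (L : Signature) where
  open Signature L

  infix  10 !_
  infixl 9 _·_ _⋆_ _▹_
  infixl 8 _+_ _⊔_
  infix  7 [_]_ ⟨_⟩_
  infixr 6 _∧_
  infixr 5 _∨_
  infixr 4 _⇒_

  mutual
    data PrfTm : Set where
      con : PrfConst → PrfTm
      var : PrfVar → PrfTm
      _·_ : PrfTm → PrfTm → PrfTm
      _+_ : PrfTm → PrfTm → PrfTm
      !_  : PrfTm → PrfTm
      _▹_ : SatTm → PrfTm → PrfTm

    data SatTm : Set where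
      var : SatVar → SatTm
      _⊔_ : SatTm → SatTm → SatTm
      _⋆_ : PrfTm → SatTm → SatTm

  data Fm : Set where
    atom        : PropVar → Fm
    bot         : Fm
    _∧_ _∨_ _⇒_ : Fm → Fm → Fm
    [_]_        : PrfTm → Fm → Fm
    ⟨_⟩_        : SatTm → Fm → Fm

-- Formulas of intuitionistic propositional logic over the variables ℕ.  They
-- double as axiom schemes, their variables being the schematic letters.
data Scheme : Set where
  letter         : ℕ → Scheme
  botˢ           : Scheme
  _∧ˢ_ _∨ˢ_ _⇒ˢ_ : Scheme → Scheme → Scheme

_⟪_⟫ˢ : Scheme → (ℕ → Scheme) → Scheme
letter i  ⟪ σ ⟫ˢ = σ i
botˢ      ⟪ σ ⟫ˢ = botˢ
(S ∧ˢ T)  ⟪ σ ⟫ˢ = (S ⟪ σ ⟫ˢ) ∧ˢ (T ⟪ σ ⟫ˢ)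
(S ∨ˢ T)  ⟪ σ ⟫ˢ = (S ⟪ σ ⟫ˢ) ∨ˢ (T ⟪ σ ⟫ˢ)
(S ⇒ˢ T)  ⟪ σ ⟫ˢ = (S ⟪ σ ⟫ˢ) ⇒ˢ (T ⟪ σ ⟫ˢ)

_⟪_⟫ : ∀ {L} → Scheme → (ℕ → Fm L) → Fm L
letter i  ⟪ σ ⟫ = σ i
botˢ      ⟪ σ ⟫ = bot
(S ∧ˢ T)  ⟪ σ ⟫ = (S ⟪ σ ⟫) ∧ (T ⟪ σ ⟫)
(S ∨ˢ T)  ⟪ σ ⟫ = (S ⟪ σ ⟫) ∨ (T ⟪ σ ⟫)
(S ⇒ˢ T)  ⟪ σ ⟫ = (S ⟪ σ ⟫) ⇒ (T ⟪ σ ⟫)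

infix 3 _⊢ᴺᴶ_ _⊢ᴴ_

-- Natural deduction for intuitionistic propositional logic.
data _⊢ᴺᴶ_ : List Scheme → Scheme → Set where
  hyp : ∀ {Γ S}     → S ∈ˡ Γ → Γ ⊢ᴺᴶ S
  ⊥E  : ∀ {Γ S}     → Γ ⊢ᴺᴶ botˢ → Γ ⊢ᴺᴶ S
  ∧I  : ∀ {Γ S T}   → Γ ⊢ᴺᴶ S → Γ ⊢ᴺᴶ T → Γ ⊢ᴺᴶ S ∧ˢ T
  ∧E₁ : ∀ {Γ S T}   → Γ ⊢ᴺᴶ S ∧ˢ T → Γ ⊢ᴺᴶ S
  ∧E₂ : ∀ {Γ S T}   → Γ ⊢ᴺᴶ S ∧ˢ T → Γ ⊢ᴺᴶ T
  ∨I₁ : ∀ {Γ S T}   → Γ ⊢ᴺᴶ S → Γ ⊢ᴺᴶ S ∨ˢ T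
  ∨I₂ : ∀ {Γ S T}   → Γ ⊢ᴺᴶ T → Γ ⊢ᴺᴶ S ∨ˢ T
  ∨E  : ∀ {Γ S T U} → Γ ⊢ᴺᴶ S ∨ˢ T → S ∷ Γ ⊢ᴺᴶ U → T ∷ Γ ⊢ᴺᴶ U → Γ ⊢ᴺᴶ U
  ⇒I  : ∀ {Γ S T}   → S ∷ Γ ⊢ᴺᴶ T → Γ ⊢ᴺᴶ S ⇒ˢ T
  ⇒E  : ∀ {Γ S T}   → Γ ⊢ᴺᴶ S ⇒ˢ T → Γ ⊢ᴺᴶ S → Γ ⊢ᴺᴶ T

data _⊢ᴴ_ (Int : List Scheme) : Scheme → Set where
  ax : ∀ {S} (σ : ℕ → Scheme) → S ∈ˡ Int → Int ⊢ᴴ S ⟪ σ ⟫ˢ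
  mp : ∀ {S T} → Int ⊢ᴴ S → Int ⊢ᴴ S ⇒ˢ T → Int ⊢ᴴ T

-- With modus ponens as the only rule, the schemes Int yield exactly the
-- theorems of intuitionistic propositional logic.
AxiomatizesIPL : List Scheme → Set
AxiomatizesIPL Int = ∀ S → (Int ⊢ᴴ S) ⇔ ([] ⊢ᴺᴶ S)

module _ {L : Signature} where
  open Signature L

  data Base (Int : List Scheme) : Pred (Fm L) 0ℓ where
    int  : ∀ {S} (σ : ℕ → Fm L) → S ∈ˡ Int → Base Int (S ⟪ σ ⟫)
    k□   : ∀ s t A B → Base Int ([ s ] (A ⇒ B) ⇒ ([ t ] A ⇒ [ s · t ] B))
    k◇   : ∀ s m A B → Base Int ([ s ] (A ⇒ B) ⇒ (⟨ m ⟩ A ⇒ ⟨ s ⋆ m ⟩ B))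
    ◇∨   : ∀ m A B   → Base Int (⟨ m ⟩ (A ∨ B) ⇒ (⟨ m ⟩ A ∨ ⟨ m ⟩ B))
    ◇□   : ∀ m t A B → Base Int ((⟨ m ⟩ A ⇒ [ t ] B) ⇒ [ m ▹ t ] (A ⇒ B))
    ◇⊥   : ∀ m       → Base Int (⟨ m ⟩ bot ⇒ bot)
    +ˡ   : ∀ s t A   → Base Int ([ s ] A ⇒ [ s + t ] A)
    +ʳ   : ∀ s t A   → Base Int ([ t ] A ⇒ [ s + t ] A)
    ⊔ˡ   : ∀ m n A   → Base Int (⟨ m ⟩ A ⇒ ⟨ m ⊔ n ⟩ A)
    ⊔ʳ   : ∀ m n A   → Base Int (⟨ n ⟩ A ⇒ ⟨ m ⊔ n ⟩ A)

  IsConstantSpecification : ∀ {c} → List Scheme → Pred (Fm L) c → Set c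
  IsConstantSpecification Int CS =
    CS ⊆ λ F → ∃₂ λ (k : PrfConst) A → F ≡ [ con k ] A × A ∈ Base Int

  bangs : ℕ → PrfConst → PrfTm L
  bangs zero    k = con k
  bangs (suc i) k = ! bangs i k

  -- canFm i k A is [ !ⁱ k ] ⋯ [ ! k ] [ k ] A.
  canFm : ℕ → PrfConst → Fm L → Fm L
  canFm zero    k A = [ con k ] A
  canFm (suc i) k A = [ bangs (suc i) k ] canFm i k A

  data CanConclusion {c} (CS : Pred (Fm L) c) : Pred (Fm L) c where
    can : ∀ i {k A} → [ con k ] A ∈ CS → CanConclusion CS (canFm i k A)

  data JIK {c} (Int : List Scheme) (CS : Pred (Fm L) c) (Γ : List (Fm L)) :
           Pred (Fm L) c where
    ax  : ∀ {A}   → A ∈ Base Int → JIK Int CS Γ A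
    id  : ∀ {A}   → A ∈ˡ Γ → JIK Int CS Γ A
    mp  : ∀ {A B} → JIK Int CS Γ A → JIK Int CS Γ (A ⇒ B) → JIK Int CS Γ B
    can : ∀ {A}   → A ∈ CanConclusion CS → JIK Int CS Γ A

  infixl 9 _∙_

  _∙_ : ∀ {ℓ} → Pred (Fm L) ℓ → Pred (Fm L) ℓ → Pred (Fm L) ℓ
  (X ∙ Y) B = ∃ λ A → (A ⇒ B) ∈ X × A ∈ Y

  record BasicModel {c} (CS : Pred (Fm L) c) (ℓ : Level) : Set (c ℓ⊔ lsuc ℓ) where
    infix 4 _≤_
    field
      W          : Set ℓ
      inhabitant : W
      _≤_        : Rel W ℓ
      isPreorder : IsPreorder _≡_ _≤_
      val        : PropVar → W → Bool
      prf        : PrfTm L → W → Pred (Fm L) ℓ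
      sat        : SatTm L → W → Pred (Fm L) ℓ

      val-mono : ∀ p {w v} → w ≤ v → val p w ≡ true → val p v ≡ true
      prf-mono : ∀ t {w v} → w ≤ v → prf t w ⊆ prf t v
      sat-mono : ∀ m {w v} → w ≤ v → sat m w ⊆ sat m v

      app-prf : ∀ s t w → prf s w ∙ prf t w ⊆ prf (s · t) w
      app-sat : ∀ s m w → prf s w ∙ sat m w ⊆ sat (s ⋆ m) w
      sum-prf : ∀ s t w → prf s w ∪ prf t w ⊆ prf (s + t) w
      sum-sat : ∀ m n w → sat m w ∪ sat n w ⊆ sat (m ⊔ n) w
      can-prf : ∀ t A w → [ t ] A ∈ CanConclusion CS → A ∈ prf t w
      or-sat  : ∀ m A B w → (A ∨ B) ∈ sat m w → A ∈ sat m w ⊎ B ∈ sat m w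
      -- Constructively this premise is stronger than A ∈ sat m v → B ∈ prf t v;
      -- the two agree under excluded middle.
      imp-prf : ∀ m t A B w →
                (∀ v → w ≤ v → A ∉ sat m v ⊎ B ∈ prf t v) →
                (A ⇒ B) ∈ prf (m ▹ t) w
      bot-sat : ∀ m w → bot ∉ sat m w

    infix 3 _⊩_

    _⊩_ : W → Fm L → Set ℓ
    w ⊩ atom p    = Lift ℓ (val p w ≡ true)
    w ⊩ bot       = ⊥
    w ⊩ A ∧ B     = w ⊩ A × w ⊩ B
    w ⊩ A ∨ B     = w ⊩ A ⊎ w ⊩ B
    w ⊩ A ⇒ B     = ∀ v → w ≤ v → v ⊩ A → v ⊩ B
    w ⊩ [ t ] A   = A ∈ prf t w
    w ⊩ ⟨ m ⟩ A   = A ∈ sat m w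

  record QuasiModel {c} (CS : Pred (Fm L) c) (ℓ : Level) : Set (c ℓ⊔ lsuc ℓ) where
    field
      basic : BasicModel CS ℓ
    open BasicModel basic public
    field
      R : Rel W ℓ

  -- Non-emptiness of W, the preorder laws and monotonicity of val, which a
  -- birelational model also needs, are already part of a basic model.
  record IsModular {c} {CS : Pred (Fm L) c} {ℓ} (M : QuasiModel CS ℓ) : Set ℓ where
    open QuasiModel M
    field
      BC  : ∀ {w v v′} → R w v → v ≤ v′ → Σ[ w′ ∈ W ] w ≤ w′ × R w′ v′
      FC  : ∀ {w w′ v} → w ≤ w′ → R w v → Σ[ v′ ∈ W ] R w′ v′ × v ≤ v′
      JYB : ∀ w t A → A ∈ prf t w → ∀ w′ v′ → w ≤ w′ → R w′ v′ → v′ ⊩ A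
      SYP : ∀ w m A → A ∈ sat m w → Σ[ v ∈ W ] R w v × v ⊩ A

  -- Truth at every world of every intuitionistic modular model for CS.
  Valid : ∀ {c} → Pred (Fm L) c → (ℓ : Level) → Fm L → Set (c ℓ⊔ lsuc ℓ)
  Valid CS ℓ A = (M : QuasiModel CS ℓ) → IsModular M →
                 ∀ w → QuasiModel._⊩_ M w A

{-# OPTIONS --safe #-}

-- The theorem already holds in every basic model: truth persists along ≤, and
-- each modal axiom is forced by the closure condition (1)–(8) on its terms; an
-- axiom of Int is an intuitionistic theorem, hence forced by soundness of
-- natural deduction for Kripke semantics.  The relation R plays no role, since
-- truth of [ t ] A and ⟨ m ⟩ A is read off from *.

module Submission where

open import Axiom.ExcludedMiddle using (ExcludedMiddle)
open import Data.Empty using () renaming (⊥-elim to ⊥-elim₀)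
open import Data.Empty.Polymorphic using (⊥-elim)
open import Data.List using (List; [])
open import Data.List.Membership.Propositional using () renaming (_∈_ to _∈ˡ_)
open import Data.List.Relation.Unary.All as All using (All; []; _∷_)
open import Data.Nat using (ℕ; zero; suc)
open import Data.Product using (_,_; proj₁; proj₂)
open import Data.Sum using (inj₁; inj₂; [_,_]′)
open import Function using (_∘_)
open import Function.Bundles using (Equivalence)
open import Level using (lift)
open import Relation.Binary using (IsPreorder)
open import Relation.Binary.PropositionalEquality using (_≡_; refl; cong₂; subst)
open import Relation.Nullary.Decidable using (toSum)
open import Relation.Unary using (Pred; _∈_)
open import Defs

letter-⟪⟫ˢ : ∀ S → S ⟪ letter ⟫ˢ ≡ S
letter-⟪⟫ˢ (letter i) = refl
letter-⟪⟫ˢ botˢ       = refl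
letter-⟪⟫ˢ (S ∧ˢ T)   = cong₂ _∧ˢ_ (letter-⟪⟫ˢ S) (letter-⟪⟫ˢ T)
letter-⟪⟫ˢ (S ∨ˢ T)   = cong₂ _∨ˢ_ (letter-⟪⟫ˢ S) (letter-⟪⟫ˢ T)
letter-⟪⟫ˢ (S ⇒ˢ T)   = cong₂ _⇒ˢ_ (letter-⟪⟫ˢ S) (letter-⟪⟫ˢ T)

-- `ax` yields only substitution instances; the identity substitution `letter` recovers the scheme
-- itself.
axiom⇒NJ : ∀ {Int S} → AxiomatizesIPL Int → S ∈ˡ Int → [] ⊢ᴺᴶ S
axiom⇒NJ {Int} {S} ipl S∈Int =
  Equivalence.to (ipl S) (subst (Int ⊢ᴴ_) (letter-⟪⟫ˢ S) (ax letter S∈Int))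

module _ {c ℓ} {L : Signature} {CS : Pred (Fm L) c} (B : BasicModel CS ℓ) where
  open BasicModel B
  open IsPreorder isPreorder using () renaming (refl to ≤-refl; trans to ≤-trans)

  ⊩-mono : ∀ A {w v} → w ≤ v → w ⊩ A → v ⊩ A
  ⊩-mono (atom p)  w≤v (lift e)  = lift (val-mono p w≤v e)
  ⊩-mono (A ∧ A′)  w≤v (a , a′)  = ⊩-mono A w≤v a , ⊩-mono A′ w≤v a′
  ⊩-mono (A ∨ A′)  w≤v (inj₁ a)  = inj₁ (⊩-mono A w≤v a)
  ⊩-mono (A ∨ A′)  w≤v (inj₂ a′) = inj₂ (⊩-mono A′ w≤v a′)
  ⊩-mono (A ⇒ A′)  w≤v f u v≤u   = f u (≤-trans w≤v v≤u)
  ⊩-mono ([ t ] A) w≤v           = prf-mono t w≤v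
  ⊩-mono (⟨ m ⟩ A) w≤v           = sat-mono m w≤v

  module _ (σ : ℕ → Fm L) where

    -- Each letter `i` denotes the set of worlds forcing `σ i`. That set is closed under `≤` even
    -- when `σ i` is modal, so the usual Kripke argument applies.
    NJ-sound : ∀ {Γ S} → Γ ⊢ᴺᴶ S → ∀ w → All (λ T → w ⊩ T ⟪ σ ⟫) Γ → w ⊩ S ⟪ σ ⟫
    NJ-sound (hyp S∈Γ)  w γ = All.lookup γ S∈Γ
    NJ-sound (⊥E d)     w γ = ⊥-elim (NJ-sound d w γ)
    NJ-sound (∧I d e)   w γ = NJ-sound d w γ , NJ-sound e w γ
    NJ-sound (∧E₁ d)    w γ = proj₁ (NJ-sound d w γ)
    NJ-sound (∧E₂ d)    w γ = proj₂ (NJ-sound d w γ)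
    NJ-sound (∨I₁ d)    w γ = inj₁ (NJ-sound d w γ)
    NJ-sound (∨I₂ d)    w γ = inj₂ (NJ-sound d w γ)
    NJ-sound (∨E d e f) w γ =
      [ (λ s → NJ-sound e w (s ∷ γ)) , (λ t → NJ-sound f w (t ∷ γ)) ]′ (NJ-sound d w γ)
    NJ-sound (⇒I d)     w γ v w≤v s =
      -- The premise is used at the later world `v`, so the hypotheses must persist from `w` to `v`.
      NJ-sound d v (s ∷ All.map (λ {T} → ⊩-mono (T ⟪ σ ⟫) w≤v) γ)
    NJ-sound (⇒E d e)   w γ = NJ-sound d w γ w ≤-refl (NJ-sound e w γ)

  can-sound : ∀ {A} → A ∈ CanConclusion CS → ∀ w → w ⊩ A
  -- Splitting on the exponent lets `canFm` reduce and expose its outermost box.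
  can-sound (can zero    h) w = can-prf _ _ w (can zero h)
  can-sound (can (suc i) h) w = can-prf _ _ w (can (suc i) h)

  module _ (em : ExcludedMiddle ℓ) {Int : List Scheme} (ipl : AxiomatizesIPL Int) where

    Base-sound : ∀ {A} → A ∈ Base Int → ∀ w → w ⊩ A
    Base-sound (int σ S∈Int) w = NJ-sound σ (axiom⇒NJ ipl S∈Int) w []
    -- The evidence `f` lives at `v` but `a` at the later `u`; (M2) moves `f` to `u`, where
    -- condition (1) joins them.
    Base-sound (k□ s t A _) w v _ f u v≤u a = app-prf s t u (A , prf-mono s v≤u f , a)
    Base-sound (k◇ s m A _) w v _ f u v≤u a = app-sat s m u (A , prf-mono s v≤u f , a)
    Base-sound (◇∨ m A A′) w v _ = or-sat m A A′ v
    Base-sound (◇□ m t A A′) w v _ f = imp-prf m t A A′ v λ u v≤u →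
      -- Condition (7) asks for a disjunction at each `u`, while `f` gives an implication; deciding
      -- `A ∈ sat m u` converts one into the other.
      [ inj₂ ∘ f u v≤u , inj₁ ]′ (toSum (em {A ∈ sat m u}))
    Base-sound (◇⊥ m) w v _ b = ⊥-elim₀ (bot-sat m v b)
    Base-sound (+ˡ s t _) w v _ = sum-prf s t v ∘ inj₁
    Base-sound (+ʳ s t _) w v _ = sum-prf s t v ∘ inj₂
    Base-sound (⊔ˡ m n _) w v _ = sum-sat m n v ∘ inj₁
    Base-sound (⊔ʳ m n _) w v _ = sum-sat m n v ∘ inj₂

    JIK-sound : ∀ {Γ A} → JIK Int CS Γ A → ∀ w → All (w ⊩_) Γ → w ⊩ A
    JIK-sound (ax A∈Base) w γ = Base-sound A∈Base w
    JIK-sound (id A∈Γ)    w γ = All.lookup γ A∈Γ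
    -- Reflexivity lets the implication be applied at `w` itself.
    JIK-sound (mp d e)    w γ = JIK-sound e w γ w ≤-refl (JIK-sound d w γ)
    JIK-sound (can A∈can) w γ = can-sound A∈can w

theorem4p6 : ∀ {c ℓ} → ExcludedMiddle ℓ →
    (L : Signature) (Int : List Scheme) → AxiomatizesIPL Int →
    (CS : Pred (Fm L) c) → IsConstantSpecification Int CS →
    (A : Fm L) → JIK Int CS [] A → Valid CS ℓ A
theorem4p6 em L Int ipl CS _ A d M _ w = JIK-sound (QuasiModel.basic M) em ipl d w []
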